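{- Let $\mathcal{P}\subseteq\mathbb{R}^n_{\ge0}$ be a fixed polytope and let $\mathcal{A}$ be a face-preserving rounding algorithm for unweighted $(Q^{\mathcal{P}})$ that, given $x\in\mathcal{P}$, returns an extreme point $\hat x$ of $\mathcal{P}$ with $Ax-\Delta\le A\hat x\le Ax+\Delta$, where $\Delta\in\mathbb{R}^m_{\ge0}$ may depend on $A$ and $c$ but not on $b$. Then, using a single call to $\mathcal{A}$, one can obtain an extreme point $\tilde x$ of $\mathcal{P}$ such that $c^\intercal\tilde x\le\mathrm{OPT}^{\mathcal{P}}$ and $A\tilde x\le b+2\Delta$.
   Context: Problem $(Q^{\mathcal{P}})$: given $c\in\mathbb{R}^n_{\ge0}$, $A\in\mathbb{R}^{m\times n}_{\ge0}$, $b\in\mathbb{R}^m_{\ge0}$, find $\min c^\intercal x$ subject to $x$ being an extreme point of $\mathcal{P}$ and $Ax\le b$. $\mathrm{OPT}^{\mathcal{P}}$ is the optimal value of the LP relaxation $\min\{c^\intercal x: x\in\mathcal{P},\ Ax\le b\}$. A face-preserving rounding algorithm (FPRA) for unweighted $(Q^{\mathcal{P}})$ is an algorithm that given any $x\in\mathcal{P}$ finds in polynomial time an extreme point $\hat x$ of $\mathcal{P}$ lying in the minimal face of $\mathcal{P}$ containing $x$. -}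

module Defs where

open import Algebra.Bundles using (CommutativeRing)
open import Data.Nat.Base using (ℕ)
open import Data.Product.Base using (∃; ∃-syntax; _×_)
open import Data.Vec.Functional using (Vector; zipWith; replicate)
open import Data.Vec.Functional.Relation.Binary.Pointwise using (Pointwise)
open import Level using (0ℓ; suc)
open import Relation.Binary.Core using (Rel)
open import Relation.Binary.Structures using (IsDecTotalOrder)
open import Relation.Nullary.Negation.Core using (¬_)
open import Relation.Unary using (Pred; _∈_; _⊆′_; _≐′_)
import Algebra.Properties.Semiring.Sum as Sum

-- The real numbers, axiomatised as a Dedekind-complete ordered field. The
-- order is a decidable total order, as is classically the case for ℝ.
record RealField : Set (suc 0ℓ) where
  infix 4 _≤_ _<_
  field
    commutativeRing : CommutativeRing 0ℓ 0ℓ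

  open CommutativeRing commutativeRing public
    hiding (isEquivalence; refl; reflexive; sym; trans)

  field
    _≤_             : Rel Carrier 0ℓ
    isDecTotalOrder : IsDecTotalOrder _≈_ _≤_
    +-monoˡ-≤       : ∀ x {y z} → y ≤ z → y + x ≤ z + x
    *-nonneg        : ∀ {x y} → 0# ≤ x → 0# ≤ y → 0# ≤ x * y
    0≉1             : ¬ (0# ≈ 1#)
    inverse         : ∀ x → ¬ (x ≈ 0#) → ∃[ y ] x * y ≈ 1#

  _<_ : Rel Carrier 0ℓ
  x < y = x ≤ y × ¬ (x ≈ y)

  UpperBound : Pred Carrier 0ℓ → Pred Carrier 0ℓ
  UpperBound S u = ∀ x → x ∈ S → x ≤ u

  field
    complete : (S : Pred Carrier 0ℓ) → ∃ S → ∃ (UpperBound S) →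
               ∃[ s ] s ∈ UpperBound S × (∀ u → u ∈ UpperBound S → s ≤ u)

module Polytopes (ℝ : RealField) where

  open RealField ℝ
  open Sum semiring using (sum)

  infix  4 _≤ᵛ_ _≈ᵛ_
  infixl 6 _+ᵛ_ _-ᵛ_
  infixr 7 _·_ _*ᵛ_ _∙_

  Point : ℕ → Set
  Point n = Vector Carrier n

  -- m rows, n columns
  Matrix : ℕ → ℕ → Set
  Matrix m n = Vector (Point n) m

  _≤ᵛ_ _≈ᵛ_ : ∀ {n} → Rel (Point n) 0ℓ
  _≤ᵛ_ = Pointwise _≤_
  _≈ᵛ_ = Pointwise _≈_

  0ᵛ : ∀ {n} → Point n
  0ᵛ = replicate _ 0#

  _+ᵛ_ _-ᵛ_ : ∀ {n} → Point n → Point n → Point n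
  _+ᵛ_ = zipWith _+_
  _-ᵛ_ = zipWith _-_

  _*ᵛ_ : ∀ {n} → Carrier → Point n → Point n
  (t *ᵛ x) i = t * x i

  _∙_ : ∀ {n} → Point n → Point n → Carrier
  x ∙ y = sum (zipWith _*_ x y)

  _·_ : ∀ {m n} → Matrix m n → Point n → Point m
  (A · x) i = A i ∙ x

  -- A polytope is a bounded polyhedron { x | G x ≤ h }.
  record Polytope (n : ℕ) : Set where
    field
      {k}     : ℕ
      G       : Matrix k n
      h       : Point k
      bounded : ∃[ M ] ∀ x → G · x ≤ᵛ h → ∀ i → - M ≤ x i × x i ≤ M

  ⟦_⟧ : ∀ {n} → Polytope n → Pred (Point n) 0ℓ
  ⟦ P ⟧ x = Polytope.G P · x ≤ᵛ Polytope.h P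

  NonNegative : ∀ {n} → Pred (Point n) 0ℓ
  NonNegative x = 0ᵛ ≤ᵛ x

  IsExtremePoint : ∀ {n} → Polytope n → Pred (Point n) 0ℓ
  IsExtremePoint P x = x ∈ ⟦ P ⟧ ×
    (∀ y z t → y ∈ ⟦ P ⟧ → z ∈ ⟦ P ⟧ → 0# < t → t < 1# →
      x ≈ᵛ t *ᵛ y +ᵛ (1# - t) *ᵛ z → y ≈ᵛ x × z ≈ᵛ x)

  -- Faces are cut out by valid inequalities a ∙ y ≤ β. The improper faces
  -- (P itself and ∅) are included.
  IsFace : ∀ {n} → Polytope n → Pred (Pred (Point n) 0ℓ) 0ℓ
  IsFace P F = ∃[ a ] ∃[ β ]
    (∀ y → y ∈ ⟦ P ⟧ → a ∙ y ≤ β) ×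
    F ≐′ (λ y → y ∈ ⟦ P ⟧ × a ∙ y ≈ β)

  IsMinimalFace : ∀ {n} → Polytope n → Point n → Pred (Pred (Point n) 0ℓ) (suc 0ℓ)
  IsMinimalFace P x F = IsFace P F × x ∈ F ×
    (∀ F′ → IsFace P F′ → x ∈ F′ → F ⊆′ F′)

  -- The data of (Q^P) besides P: minimise c ∙ x over the extreme points x
  -- of P with A · x ≤ b.
  record Instance (m n : ℕ) : Set where
    field
      A   : Matrix m n
      b   : Point m
      c   : Point n
      A≥0 : ∀ i → A i ∈ NonNegative
      b≥0 : b ∈ NonNegative
      c≥0 : c ∈ NonNegative

  module _ {m n : ℕ} (P : Polytope n) (I : Instance m n) where
    open Instance I

    LPFeasible : Pred (Point n) 0ℓ
    LPFeasible x = x ∈ ⟦ P ⟧ × A · x ≤ᵛ b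

    -- v is the optimal value of the LP relaxation; in particular, the
    -- relaxation is feasible.
    IsOPT : Pred Carrier 0ℓ
    IsOPT v = (∃[ x ] LPFeasible x × c ∙ x ≈ v) ×
              (∀ x → LPFeasible x → v ≤ c ∙ x)

  -- No bound on the running time is imposed on round.
  record FPRA {n : ℕ} (P : Polytope n) : Set (suc 0ℓ) where
    field
      round          : ∀ {m} → Instance m n → Point n → Point n
      round-extreme  : ∀ {m} (I : Instance m n) x → x ∈ ⟦ P ⟧ →
                       IsExtremePoint P (round I x)
      face-preserving : ∀ {m} (I : Instance m n) x → x ∈ ⟦ P ⟧ →
                       ∃[ F ] IsMinimalFace P x F × round I x ∈ F

  -- An additive error is a function of A and c only, never of b.
  ErrorBound : ℕ → Set
  ErrorBound n = ∀ {m} → Matrix m n → Point n → Point m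

  errorOn : ∀ {m n} → ErrorBound n → Instance m n → Point m
  errorOn Δ I = Δ (Instance.A I) (Instance.c I)

  HasError : ∀ {n} {P : Polytope n} → FPRA P → ErrorBound n → Set
  HasError {n} {P} 𝒜 Δ = ∀ {m} (I : Instance m n) x → x ∈ ⟦ P ⟧ →
    let open Instance I
        x̂ = FPRA.round 𝒜 I x
    in  A · x -ᵛ errorOn Δ I ≤ᵛ A · x̂ × A · x̂ ≤ᵛ A · x +ᵛ errorOn Δ I

{-# OPTIONS --safe #-}

-- Round an optimum x of the LP relaxation with right-hand side b + Δ, which
-- exists by Fourier–Motzkin elimination applied to the epigraph of the
-- objective. Feasibility of the rounded point w is then immediate. For its
-- cost, let y be optimal for the right-hand side b. As w lies in the minimal
-- face of x, every constraint of P tight at x is tight at w, so x + τ (y − w)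
-- lies in P for small τ > 0; and A w ≥ A x − Δ makes it satisfy the relaxed
-- constraints when τ ≤ 1. Optimality of x yields c ∙ w ≤ c ∙ y = OPT, without
-- recourse to LP duality.
module Submission where

open import Defs
open import Data.Nat.Base using (ℕ)
open import Data.Product.Base using (∃-syntax; _×_)
open import Relation.Unary using (_∈_; _⊆′_)
import Algebra.Properties.CommutativeSemigroup as CommutativeSemigroupProperties
import Algebra.Properties.Ring as RingProperties
import Algebra.Properties.Semiring.Sum as Sum
open import Data.Empty using (⊥-elim)
open import Data.Fin.Base using (Fin; zero; suc; splitAt; _↑ˡ_; _↑ʳ_)
open import Data.List.Base as List using (List; []; _∷_; _++_; cartesianProductWith)
import Data.List.Extrema as Extrema
open import Data.List.Membership.Propositional.Properties using (∈-cartesianProductWith⁺)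
open import Data.List.Relation.Unary.All as All using (All; []; _∷_)
import Data.List.Relation.Unary.All.Properties as All
open import Data.Nat.Base as ℕ using (zero; suc)
open import Data.Product.Base using (∃; _,_; proj₁; proj₂)
open import Data.Sum.Base using (_⊎_; inj₁; inj₂)
import Data.Vec.Functional as V
import Data.Vec.Functional.Properties as V
open import Data.Vec.Functional.Relation.Binary.Pointwise.Properties using (++⁺; ++⁻)
open import Function.Base using (_∘_)
open import Level using (0ℓ)
open import Relation.Binary.Bundles using (TotalOrder)
import Relation.Binary.PropositionalEquality as ≡
import Relation.Binary.Reasoning.PartialOrder as PartialOrderReasoning
import Relation.Binary.Reasoning.Setoid as SetoidReasoning
open import Relation.Binary.Structures using (IsDecTotalOrder)
open import Relation.Nullary.Decidable.Core using (yes; no)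
open import Relation.Nullary.Negation.Core using (¬_)

-- Arithmetic of ordered fields.

module OrderedField (ℝ : RealField) where

  open RealField ℝ hiding (zero)
  open IsDecTotalOrder isDecTotalOrder public
    using (total; antisym; _≤?_; ≤-respˡ-≈; ≤-respʳ-≈)
    renaming (reflexive to ≤-reflexive; refl to ≤-refl; trans to ≤-trans)
  open IsDecTotalOrder.Eq isDecTotalOrder public
    using () renaming (refl to ≈-refl; sym to ≈-sym; trans to ≈-trans; reflexive to ≈-reflexive)
  open RingProperties ring public

  totalOrder : TotalOrder 0ℓ 0ℓ 0ℓ
  totalOrder = record { isTotalOrder = IsDecTotalOrder.isTotalOrder isDecTotalOrder }

  module ≤-Reasoning = PartialOrderReasoning (TotalOrder.poset totalOrder)

  +-monoʳ-≤ : ∀ x {y z} → y ≤ z → x + y ≤ x + z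
  +-monoʳ-≤ x {y} {z} y≤z = begin
    x + y ≈⟨ +-comm x y ⟩
    y + x ≤⟨ +-monoˡ-≤ x y≤z ⟩
    z + x ≈⟨ +-comm z x ⟩
    x + z ∎
    where open ≤-Reasoning

  +-mono-≤ : ∀ {x y u v} → x ≤ y → u ≤ v → x + u ≤ y + v
  +-mono-≤ x≤y u≤v = ≤-trans (+-monoˡ-≤ _ x≤y) (+-monoʳ-≤ _ u≤v)

  +-nonneg : ∀ {x y} → 0# ≤ x → 0# ≤ y → 0# ≤ x + y
  +-nonneg 0≤x 0≤y = ≤-respˡ-≈ (+-identityˡ 0#) (+-mono-≤ 0≤x 0≤y)

  x+[y-x]≈y : ∀ x y → x + (y - x) ≈ y
  x+[y-x]≈y x y = ≈-trans (≈-sym (+-assoc x y (- x))) (xyx⁻¹≈y x y)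

  x≤y⇒0≤y-x : ∀ {x y} → x ≤ y → 0# ≤ y - x
  x≤y⇒0≤y-x {x} x≤y = ≤-respˡ-≈ (-‿inverseʳ x) (+-monoˡ-≤ (- x) x≤y)

  0≤y-x⇒x≤y : ∀ {x y} → 0# ≤ y - x → x ≤ y
  0≤y-x⇒x≤y {x} {y} 0≤y-x =
    ≤-respˡ-≈ (+-identityʳ x) (≤-respʳ-≈ (x+[y-x]≈y x y) (+-monoʳ-≤ x 0≤y-x))

  neg-antimono-≤ : ∀ {x y} → x ≤ y → - y ≤ - x
  neg-antimono-≤ {x} {y} x≤y = 0≤y-x⇒x≤y
    (≤-respʳ-≈ (≈-trans (+-comm y (- x)) (+-congˡ (≈-sym (-‿involutive y)))) (x≤y⇒0≤y-x x≤y))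

  *-monoˡ-≤ : ∀ {r x y} → 0# ≤ r → x ≤ y → r * x ≤ r * y
  *-monoˡ-≤ {r} {x} {y} 0≤r x≤y =
    0≤y-x⇒x≤y (≤-respʳ-≈ (x[y-z]≈xy-xz r y x) (*-nonneg 0≤r (x≤y⇒0≤y-x x≤y)))

  *-monoʳ-≤ : ∀ {r x y} → 0# ≤ r → x ≤ y → x * r ≤ y * r
  *-monoʳ-≤ {r} {x} {y} 0≤r x≤y =
    ≤-respˡ-≈ (*-comm r x) (≤-respʳ-≈ (*-comm r y) (*-monoˡ-≤ 0≤r x≤y))

  0≤1 : 0# ≤ 1#
  0≤1 with total 0# 1#
  ... | inj₁ 0≤1 = 0≤1
  -- `1# ≤ 0#` makes `- 1#` nonnegative, and `1#` is the square of `- 1#`.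
  ... | inj₂ 1≤0 = ≤-respʳ-≈ (≈-trans (-1*x≈-x (- 1#)) (-‿involutive 1#)) (*-nonneg 0≤-1 0≤-1)
    where
    0≤-1 : 0# ≤ - 1#
    0≤-1 = ≤-respˡ-≈ -0#≈0# (neg-antimono-≤ 1≤0)

  0<1 : 0# < 1#
  0<1 = 0≤1 , 0≉1

  ≰⇒> : ∀ {x y} → ¬ (x ≤ y) → y < x
  ≰⇒> {x} {y} x≰y with total x y
  ... | inj₁ x≤y = ⊥-elim (x≰y x≤y)
  ... | inj₂ y≤x = y≤x , λ y≈x → x≰y (≤-reflexive (≈-sym y≈x))

  positive-inverse : ∀ {r} → 0# < r → ∃[ s ] 0# < s × s * r ≈ 1#
  positive-inverse {r} (0≤r , 0≉r) with inverse r (0≉r ∘ ≈-sym)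
  ... | s , rs≈1 = s , ≰⇒> s≰0 , sr≈1
    where
    sr≈1 : s * r ≈ 1#
    sr≈1 = ≈-trans (*-comm s r) rs≈1
    s≰0 : ¬ (s ≤ 0#)
    s≰0 s≤0 = 0≉1 (antisym 0≤1 (≤-respˡ-≈ sr≈1 (≤-respʳ-≈ (zeroˡ r) (*-monoʳ-≤ 0≤r s≤0))))

  inverse-cancel : ∀ {r s} → s * r ≈ 1# → ∀ x → s * (r * x) ≈ x
  inverse-cancel {r} {s} sr≈1 x =
    ≈-trans (≈-sym (*-assoc s r x)) (≈-trans (*-congʳ sr≈1) (*-identityˡ x))

  *-cancel-nonneg : ∀ {r x} → 0# < r → 0# ≤ r * x → 0# ≤ x
  *-cancel-nonneg {x = x} 0<r 0≤rx with positive-inverse 0<r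
  ... | s , (0≤s , _) , sr≈1 = ≤-respʳ-≈ (inverse-cancel sr≈1 x) (*-nonneg 0≤s 0≤rx)

  *-positive : ∀ {x y} → 0# < x → 0# < y → 0# < x * y
  *-positive {x} {y} 0<x (0≤y , 0≉y) with positive-inverse 0<x
  ... | s , _ , sx≈1 = *-nonneg (proj₁ 0<x) 0≤y , λ 0≈xy →
    0≉y (≈-trans (≈-sym (zeroʳ s)) (≈-trans (*-congˡ 0≈xy) (inverse-cancel sx≈1 y)))

  -- Only a positive factor may rescale an inequality without reversing it, so the sign of a
  -- coefficient survives and three normal forms remain. They drive the case split of
  -- Fourier-Motzkin elimination.
  normalise-sign : ∀ s → ∃[ r ] 0# < r × (r * s ≈ 1# ⊎ r * s ≈ 0# ⊎ r * s ≈ - 1#)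
  normalise-sign s with s ≤? 0# | 0# ≤? s
  ... | no s≰0 | _ with positive-inverse (≰⇒> s≰0)
  ...   | r , 0<r , rs≈1 = r , 0<r , inj₁ rs≈1
  normalise-sign s | yes s≤0 | yes 0≤s =
    1# , 0<1 , inj₂ (inj₁ (≈-trans (*-identityˡ s) (antisym s≤0 0≤s)))
  normalise-sign s | yes s≤0 | no 0≰s with positive-inverse 0<-s
    where
    0<-s : 0# < - s
    0<-s = ≤-respˡ-≈ -0#≈0# (neg-antimono-≤ s≤0) ,
      λ 0≈-s → 0≰s (≤-reflexive (≈-trans (≈-sym -0#≈0#) (≈-trans (-‿cong 0≈-s) (-‿involutive s))))
  ...   | r , 0<r , r[-s]≈1 = r , 0<r , inj₂ (inj₂ (≈-trans (≈-sym (-‿involutive (r * s)))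
            (-‿cong (≈-trans (-‿distribʳ-* r s) r[-s]≈1))))

  -- Extrema of finite lists and admissible step sizes.

  open Extrema totalOrder public

  between : ∀ ls us → All (λ l → All (l ≤_) us) ls →
            ∃[ y ] All (_≤ y) ls × All (y ≤_) us
  -- The default `min 0# us` covers an empty `ls`; like every lower bound, it lies below all of
  -- `us`.
  between ls us ls≤us = max (min 0# us) ls , xs≤max _ ls , All.tabulate λ u∈us →
    max≤v⁺ (All.lookup (min≤xs 0# us) u∈us) (All.map (λ l≤us → All.lookup l≤us u∈us) ls≤us)

  -- `p + τ * (h - p)` lies between `p` and `h`, so a change no larger than the slack stays
  -- admissible when scaled by at most 1.
  convex-step : ∀ {p d h τ} → p ≤ h → d ≤ h - p → 0# ≤ τ → τ ≤ 1# → p + τ * d ≤ h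
  convex-step {p} {d} {h} {τ} p≤h d≤h-p 0≤τ τ≤1 = begin
    p + τ * d       ≤⟨ +-monoʳ-≤ p (*-monoˡ-≤ 0≤τ d≤h-p) ⟩
    p + τ * (h - p) ≤⟨ +-monoʳ-≤ p (*-monoʳ-≤ (x≤y⇒0≤y-x p≤h) τ≤1) ⟩
    p + 1# * (h - p) ≈⟨ +-congˡ (*-identityˡ (h - p)) ⟩
    p + (h - p)     ≈⟨ x+[y-x]≈y p h ⟩
    h               ∎
    where open ≤-Reasoning

  step-size : ∀ {p d h} → p ≤ h → (p ≈ h → d ≤ 0#) →
              ∃[ τ₀ ] 0# < τ₀ × (∀ τ → 0# ≤ τ → τ ≤ τ₀ → p + τ * d ≤ h)
  step-size {p} {d} {h} p≤h tight with d ≤? 0#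
  ... | yes d≤0 = 1# , 0<1 , λ τ 0≤τ τ≤1 →
    convex-step p≤h (≤-trans d≤0 (x≤y⇒0≤y-x p≤h)) 0≤τ τ≤1
  ... | no d≰0 with positive-inverse (≰⇒> d≰0)
  -- Since `s` is `1 / d`, this is the ratio `(h - p) / d` at which the bound `h` is reached. It is
  -- positive, because `p ≈ h` would force `d ≤ 0#`.
  ...   | s , 0<s , sd≈1 = (h - p) * s , *-positive 0<h-p 0<s , λ τ 0≤τ τ≤τ₀ → begin
    p + τ * d               ≤⟨ +-monoʳ-≤ p (*-monoʳ-≤ (proj₁ (≰⇒> d≰0)) τ≤τ₀) ⟩
    p + (h - p) * s * d     ≈⟨ +-congˡ (*-assoc (h - p) s d) ⟩
    p + (h - p) * (s * d)   ≈⟨ +-congˡ (*-congˡ sd≈1) ⟩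
    p + (h - p) * 1#        ≈⟨ +-congˡ (*-identityʳ (h - p)) ⟩
    p + (h - p)             ≈⟨ x+[y-x]≈y p h ⟩
    h                       ∎
    where
    open ≤-Reasoning
    0<h-p : 0# < h - p
    0<h-p = x≤y⇒0≤y-x p≤h , λ 0≈h-p → d≰0 (tight (≈-sym (x∙y⁻¹≈ε⇒x≈y h p (≈-sym 0≈h-p))))

  -- A minimum of finitely many positive numbers is positive. Including 1 in it settles the case of
  -- no rows and supplies the cap that `convex-step` requires.
  common-step-size : ∀ {k} (Q : Fin k → Carrier → Set) →
    (∀ i → ∃[ τ₀ ] 0# < τ₀ × (∀ τ → 0# ≤ τ → τ ≤ τ₀ → Q i τ)) →
    ∃[ τ ] 0# < τ × τ ≤ 1# × (∀ i → Q i τ)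
  common-step-size Q bound = τ , 0<τ , min≤⊤ 1# bounds , λ i →
    proj₂ (proj₂ (bound i)) τ (proj₁ 0<τ) (All.tabulate⁻ (min≤xs 1# bounds) i)
    where
    bounds = List.tabulate (proj₁ ∘ bound)
    τ = min 1# bounds
    0<τ : 0# < τ
    0<τ = v<min⁺ 0<1 (All.tabulate⁺ (proj₁ ∘ proj₂ ∘ bound))

-- Linear forms on coordinate space.

module LinearForms (ℝ : RealField) where

  open RealField ℝ hiding (zero)
  open Polytopes ℝ
  open OrderedField ℝ
  open Sum semiring
  open CommutativeSemigroupProperties *-commutativeSemigroup using (x∙yz≈y∙xz)

  ∙-cong : ∀ {n} {a b x y : Point n} → a ≈ᵛ b → x ≈ᵛ y → a ∙ x ≈ b ∙ y
  ∙-cong a≈b x≈y = sum-cong-≋ λ i → *-cong (a≈b i) (x≈y i)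

  ∙-congˡ : ∀ {n} (a : Point n) {x y} → x ≈ᵛ y → a ∙ x ≈ a ∙ y
  ∙-congˡ a = ∙-cong {a = a} λ _ → ≈-refl

  ∙-comm : ∀ {n} (x y : Point n) → x ∙ y ≈ y ∙ x
  ∙-comm x y = sum-cong-≋ λ i → *-comm (x i) (y i)

  ∙-distribˡ-+ᵛ : ∀ {n} (a x y : Point n) → a ∙ (x +ᵛ y) ≈ a ∙ x + a ∙ y
  ∙-distribˡ-+ᵛ a x y =
    ≈-trans (sum-cong-≋ λ i → distribˡ (a i) (x i) (y i))
      (∑-distrib-+ (V.zipWith _*_ a x) (V.zipWith _*_ a y))

  ∙-*ᵛ : ∀ {n} (a : Point n) r x → a ∙ (r *ᵛ x) ≈ r * (a ∙ x)
  ∙-*ᵛ a r x =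
    ≈-trans (sum-cong-≋ λ i → x∙yz≈y∙xz (a i) r (x i))
      (≈-sym (*-distribˡ-sum r (V.zipWith _*_ a x)))

  +ᵛ-∙ : ∀ {n} (a b x : Point n) → (a +ᵛ b) ∙ x ≈ a ∙ x + b ∙ x
  +ᵛ-∙ a b x = ≈-trans (∙-comm (a +ᵛ b) x)
    (≈-trans (∙-distribˡ-+ᵛ x a b) (+-cong (∙-comm x a) (∙-comm x b)))

  *ᵛ-∙ : ∀ {n} r (a x : Point n) → (r *ᵛ a) ∙ x ≈ r * (a ∙ x)
  *ᵛ-∙ r a x = ≈-trans (∙-comm (r *ᵛ a) x) (≈-trans (∙-*ᵛ x r a) (*-congˡ (∙-comm x a)))

  negᵛ : ∀ {n} → Point n → Point n
  negᵛ a = - 1# *ᵛ a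

  negᵛ-∙ : ∀ {n} (a x : Point n) → negᵛ a ∙ x ≈ - (a ∙ x)
  negᵛ-∙ a x = ≈-trans (*ᵛ-∙ (- 1#) a x) (-1*x≈-x (a ∙ x))

  -- The direction is `y - w` and not `y - x`: the point need not lie on the segment from `x` to
  -- `y`.
  towards : ∀ {n} → Carrier → Point n → Point n → Point n → Point n
  towards τ x y w = x +ᵛ τ *ᵛ (y +ᵛ negᵛ w)

  ∙-towards : ∀ {n} (a : Point n) τ x y w → a ∙ towards τ x y w ≈ a ∙ x + τ * (a ∙ y - a ∙ w)
  ∙-towards a τ x y w = begin
    a ∙ towards τ x y w                   ≈⟨ ∙-distribˡ-+ᵛ a x _ ⟩
    a ∙ x + a ∙ (τ *ᵛ (y +ᵛ negᵛ w))        ≈⟨ +-congˡ (∙-*ᵛ a τ _) ⟩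
    a ∙ x + τ * (a ∙ (y +ᵛ negᵛ w))         ≈⟨ +-congˡ (*-congˡ (∙-distribˡ-+ᵛ a y (negᵛ w))) ⟩
    a ∙ x + τ * (a ∙ y + a ∙ (negᵛ w))
      ≈⟨ +-congˡ (*-congˡ (+-congˡ (≈-trans (∙-*ᵛ a (- 1#) w) (-1*x≈-x (a ∙ w))))) ⟩
    a ∙ x + τ * (a ∙ y - a ∙ w)           ∎
    where open SetoidReasoning setoid

  ++-∙ : ∀ {n k} (a : Point n) (b : Point k) z →
         (a V.++ b) ∙ z ≈ a ∙ (z ∘ (_↑ˡ k)) + b ∙ (z ∘ (n ↑ʳ_))
  ++-∙ {zero}  a b z = ≈-sym (+-identityˡ _)
  ++-∙ {suc n} {k} a b z = begin
    a zero * z zero + (V.tail (a V.++ b)) ∙ V.tail z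
      ≈⟨ +-congˡ (∙-cong tail-++ λ _ → ≈-refl) ⟩
    a zero * z zero + (V.tail a V.++ b) ∙ V.tail z
      ≈⟨ +-congˡ (++-∙ (V.tail a) b (V.tail z)) ⟩
    a zero * z zero + (V.tail a ∙ (V.tail z ∘ (_↑ˡ k)) + b ∙ (V.tail z ∘ (n ↑ʳ_)))
      ≈⟨ +-assoc _ _ _ ⟨
    a ∙ (z ∘ (_↑ˡ k)) + b ∙ (z ∘ (suc n ↑ʳ_)) ∎
    where
    open SetoidReasoning setoid
    -- Concatenation computes through `splitAt`, so the equation appears only after a case split on
    -- its result.
    tail-++ : V.tail (a V.++ b) ≈ᵛ V.tail a V.++ b
    tail-++ i with splitAt n i
    ... | inj₁ _ = ≈-refl
    ... | inj₂ _ = ≈-refl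

-- Fourier-Motzkin elimination and attainment of minima.

module FourierMotzkin (ℝ : RealField) where

  open RealField ℝ hiding (zero)
  open Polytopes ℝ
  open OrderedField ℝ
  open LinearForms ℝ

  -- A list of forms a stands for the homogeneous system 0 ≤ a ∙ x.
  System : ℕ → Set
  System n = List (Point n)

  Sat : ∀ {n} → System n → Point n → Set
  Sat L x = All (λ a → 0# ≤ a ∙ x) L

  Sat-cong : ∀ {n} (L : System n) {x y} → x ≈ᵛ y → Sat L x → Sat L y
  Sat-cong L x≈y = All.map λ {a} → ≤-respʳ-≈ (∙-congˡ a x≈y)

  -- Rows whose leading coefficient has been normalised to 1 or -1 and then dropped: they read
  -- `- (a ∙ z) ≤ y` and `y ≤ a ∙ z` respectively.
  LowerBounds UpperBounds : ∀ {n} → System n → Carrier → Point n → Set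
  LowerBounds L y z = All (λ a → 0# ≤ y + a ∙ z) L
  UpperBounds L y z = All (λ a → 0# ≤ - y + a ∙ z) L

  record Split {n} (L : System (suc n)) : Set where
    field
      lowers uppers rest : System n
      project    : ∀ x → Sat L x → LowerBounds lowers (V.head x) (V.tail x) ×
                 UpperBounds uppers (V.head x) (V.tail x) × Sat rest (V.tail x)
      lift : ∀ y z → LowerBounds lowers y z → UpperBounds uppers y z →
                 Sat rest z → Sat L (y V.∷ z)

  module _ {n} (a : Point (suc n)) {r} (0<r : 0# < r) where

    private
      a′ = r *ᵛ V.tail a

      scaled : ∀ {σ} x → r * V.head a ≈ σ →
               r * (a ∙ x) ≈ σ * V.head x + a′ ∙ V.tail x
      scaled x ra≈σ = ≈-trans (distribˡ r _ _) (+-cong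
        (≈-trans (≈-sym (*-assoc r _ _)) (*-congʳ ra≈σ)) (≈-sym (*ᵛ-∙ r (V.tail a) (V.tail x))))

    -- `σ` stands for the normalised coefficient 1, 0 or -1, and `u` for the simplified form of
    -- `σ * V.head x`; one statement thus serves all three kinds of row.
    eliminate⁺ : ∀ {σ u} x → r * V.head a ≈ σ → σ * V.head x ≈ u →
                 0# ≤ a ∙ x → 0# ≤ u + a′ ∙ V.tail x
    eliminate⁺ x ra≈σ σx≈u 0≤ax =
      ≤-respʳ-≈ (≈-trans (scaled x ra≈σ) (+-congʳ σx≈u)) (*-nonneg (proj₁ 0<r) 0≤ax)

    eliminate⁻ : ∀ {σ u} x → r * V.head a ≈ σ → σ * V.head x ≈ u →
                 0# ≤ u + a′ ∙ V.tail x → 0# ≤ a ∙ x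
    eliminate⁻ x ra≈σ σx≈u 0≤ = *-cancel-nonneg 0<r
      (≤-respʳ-≈ (≈-sym (≈-trans (scaled x ra≈σ) (+-congʳ σx≈u))) 0≤)

  split : ∀ {n} (L : System (suc n)) → Split L
  split [] = record
    { lowers = [] ; uppers = [] ; rest = []
    ; project = λ _ _ → [] , [] , [] ; lift = λ _ _ _ _ _ → [] }
  split (a ∷ L) with normalise-sign (V.head a) | split L
  ... | r , 0<r , inj₁ ra≈1 | S = record
    { lowers = (r *ᵛ V.tail a) ∷ lowers ; uppers = uppers ; rest = rest
    ; project = λ { x (p ∷ ps) → let l , u , f = project x ps in
        (eliminate⁺ a 0<r x ra≈1 (*-identityˡ _) p ∷ l) , u , f }
    ; lift = λ { y z (l ∷ ls) us fs →
        eliminate⁻ a 0<r (y V.∷ z) ra≈1 (*-identityˡ y) l ∷ lift y z ls us fs } }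
    where open Split S
  ... | r , 0<r , inj₂ (inj₁ ra≈0) | S = record
    { lowers = lowers ; uppers = uppers ; rest = (r *ᵛ V.tail a) ∷ rest
    ; project = λ { x (p ∷ ps) → let l , u , f = project x ps in
        l , u , (≤-respʳ-≈ (+-identityˡ _) (eliminate⁺ a 0<r x ra≈0 (zeroˡ _) p) ∷ f) }
    ; lift = λ { y z ls us (f ∷ fs) →
        eliminate⁻ a 0<r (y V.∷ z) ra≈0 (zeroˡ y) (≤-respʳ-≈ (≈-sym (+-identityˡ _)) f)
        ∷ lift y z ls us fs } }
    where open Split S
  ... | r , 0<r , inj₂ (inj₂ ra≈-1) | S = record
    { lowers = lowers ; uppers = (r *ᵛ V.tail a) ∷ uppers ; rest = rest
    ; project = λ { x (p ∷ ps) → let l , u , f = project x ps in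
        l , (eliminate⁺ a 0<r x ra≈-1 (-1*x≈-x _) p ∷ u) , f }
    ; lift = λ { y z ls (u ∷ us) fs →
        eliminate⁻ a 0<r (y V.∷ z) ra≈-1 (-1*x≈-x y) u ∷ lift y z ls us fs } }
    where open Split S

  0≤y+v⇒-v≤y : ∀ {y v} → 0# ≤ y + v → - v ≤ y
  0≤y+v⇒-v≤y {y} {v} p = 0≤y-x⇒x≤y (≤-respʳ-≈ (+-congˡ (≈-sym (-‿involutive v))) p)

  -v≤y⇒0≤y+v : ∀ {y v} → - v ≤ y → 0# ≤ y + v
  -v≤y⇒0≤y+v {y} {v} p = ≤-respʳ-≈ (+-congˡ (-‿involutive v)) (x≤y⇒0≤y-x p)

  y≤v⇒0≤-y+v : ∀ {y v} → y ≤ v → 0# ≤ - y + v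
  y≤v⇒0≤-y+v {y} {v} p = ≤-respʳ-≈ (+-comm v (- y)) (x≤y⇒0≤y-x p)

  0≤-y+v⇒y≤v : ∀ {y v} → 0# ≤ - y + v → y ≤ v
  0≤-y+v⇒y≤v {y} {v} p = 0≤y-x⇒x≤y (≤-respʳ-≈ (+-comm (- y) v) p)

  module _ {n} (L : System (suc n)) where

    open Split (split L)

    -- For a lower form `a` and an upper form `b`, `0# ≤ (a +ᵛ b) ∙ z` says that the lower bound
    -- `- (a ∙ z)` does not exceed the upper bound `b ∙ z`. The first coordinate cancels from this
    -- condition.
    eliminate : System n
    eliminate = rest ++ cartesianProductWith _+ᵛ_ lowers uppers

    eliminate-project : ∀ x → Sat L x → Sat eliminate (V.tail x)
    eliminate-project x satL with project x satL
    ... | ls , us , fs = All.++⁺ fs (All.cartesianProductWith⁺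
      (≡.setoid _) (≡.setoid _) _+ᵛ_ lowers uppers λ {a} {b} a∈ b∈ →
      ≤-respʳ-≈ (≈-sym (≈-trans (+ᵛ-∙ a b (V.tail x)) (+-comm _ _)))
        -- The eliminated coordinate `V.head x` itself lies between the two bounds.
        (-v≤y⇒0≤y+v (≤-trans (0≤y+v⇒-v≤y (All.lookup ls a∈)) (0≤-y+v⇒y≤v (All.lookup us b∈)))))

    eliminate-lift : ∀ z → Sat eliminate z → ∃[ y ] Sat L (y V.∷ z)
    eliminate-lift z sat with All.++⁻ rest sat
    ... | fs , pairs with between (List.map (λ a → - (a ∙ z)) lowers) (List.map (_∙ z) uppers)
          (All.map⁺ (All.tabulate λ {a} a∈ → All.map⁺ (All.tabulate λ {b} b∈ →
            0≤y+v⇒-v≤y (≤-respʳ-≈ (≈-trans (+ᵛ-∙ a b z) (+-comm _ _))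
              (All.lookup pairs (∈-cartesianProductWith⁺ _+ᵛ_ a∈ b∈))))))
    ...   | y , ls≤y , y≤us = y , lift y z
              (All.map -v≤y⇒0≤y+v (All.map⁻ ls≤y)) (All.map y≤v⇒0≤-y+v (All.map⁻ y≤us)) fs

  -- The last two of the n + 2 coordinates are the objective value and the
  -- homogenising coordinate.
  Feasible : ∀ n → System (n ℕ.+ 2) → Point (n ℕ.+ 2) → Set
  Feasible n L x = Sat L x × x (n ↑ʳ suc zero) ≈ 1#

  objective : ∀ n → Point (n ℕ.+ 2) → Carrier
  objective n x = x (n ↑ʳ zero)

  -- The objective is a coordinate that elimination never removes, so projecting and lifting
  -- preserve its value. Induction on `n` therefore reduces the problem to a single unknown, whose
  -- least admissible value is explicit.
  minimise : ∀ n (L : System (n ℕ.+ 2)) → (∀ x → Feasible n L x → 0# ≤ objective n x) →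
    ∃ (Feasible n L) →
    ∃[ x ] Feasible n L x × (∀ y → Feasible n L y → objective n x ≤ objective n y)
  minimise zero L nonneg (x , feasible) =
    (t V.∷ 1ᵛ) , (lift t 1ᵛ lower upper (proj₂ (proj₂ (bounds x feasible))) , ≈-refl) , t≤
    where
    open Split (split L)
    1ᵛ : Point 1
    1ᵛ _ = 1#
    values = List.map (λ a → - (a ∙ 1ᵛ)) lowers
    -- The default 0 covers the absence of lower bounds, and by `nonneg` it does not exceed the
    -- objective of any feasible point.
    t = max 0# values
    bounds : ∀ y → Feasible zero L y →
             LowerBounds lowers (V.head y) 1ᵛ × UpperBounds uppers (V.head y) 1ᵛ × Sat rest 1ᵛ
    bounds y (sat , y₁≈1) = project (V.head y V.∷ 1ᵛ)
      (Sat-cong L {y} {V.head y V.∷ 1ᵛ} (λ { zero → ≈-refl ; (suc zero) → y₁≈1 }) sat)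
    t≤ : ∀ y → Feasible zero L y → t ≤ V.head y
    t≤ y fy = max≤v⁺ (nonneg y fy) (All.map⁺ (All.map 0≤y+v⇒-v≤y (proj₁ (bounds y fy))))
    lower : LowerBounds lowers t 1ᵛ
    lower = All.map -v≤y⇒0≤y+v (All.map⁻ (xs≤max 0# values))
    -- The given feasible point `x` meets the upper bounds, and `t` is at most its objective value.
    upper : UpperBounds uppers t 1ᵛ
    upper = All.map (y≤v⇒0≤-y+v ∘ ≤-trans (t≤ x feasible) ∘ 0≤-y+v⇒y≤v)
      (proj₁ (proj₂ (bounds x feasible)))
  minimise (suc n) L nonneg (x , sat , x₁≈1)
    with minimise n (eliminate L)
      -- Nonnegativity passes to the eliminated system because each of its solutions lifts with the
      -- same objective.
      (λ z (satz , z₁≈1) → let y , saty = eliminate-lift L z satz in nonneg (y V.∷ z) (saty , z₁≈1))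
      (V.tail x , eliminate-project L x sat , x₁≈1)
  ... | z , (satz , z₁≈1) , z-min with eliminate-lift L z satz
  ...   | y , saty = (y V.∷ z) , (saty , z₁≈1) ,
            λ w (satw , w₁≈1) → z-min (V.tail w) (eliminate-project L w satw , w₁≈1)

-- Existence of optimal solutions of linear programs.

module LinearProgram (ℝ : RealField) where

  open RealField ℝ hiding (zero)
  open Polytopes ℝ
  open OrderedField ℝ
  open LinearForms ℝ
  open FourierMotzkin ℝ

  pair : Carrier → Carrier → Point 2
  pair s t = s V.∷ t V.∷ V.[]

  pair-∙ : ∀ s t (z : Point 2) → pair s t ∙ z ≈ s * z zero + t * z (suc zero)
  pair-∙ s t z = +-congˡ (+-identityʳ _)

  module _ {k n} (H : Matrix k n) (h : Point k) (c : Point n) where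

    -- With objective coordinate `t` and homogenising coordinate 1, the rows read `c ∙ x ≤ t` and
    -- `H i ∙ x ≤ h i`; `pair` holds the coefficients of these two extra coordinates.
    epigraph : System (n ℕ.+ 2)
    epigraph = (negᵛ c V.++ pair 1# 0#) ∷
      List.tabulate λ i → negᵛ (H i) V.++ pair 0# (h i)

    private
      form-value : ∀ a s t z → z (n ↑ʳ suc zero) ≈ 1# →
        (negᵛ a V.++ pair s t) ∙ z ≈ (s * objective n z + t) - a ∙ (z ∘ (_↑ˡ 2))
      form-value a s t z z₁≈1 = begin
        (negᵛ a V.++ pair s t) ∙ z ≈⟨ ++-∙ (negᵛ a) (pair s t) z ⟩
        negᵛ a ∙ (z ∘ (_↑ˡ 2)) + pair s t ∙ (z ∘ (n ↑ʳ_))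
          ≈⟨ +-cong (negᵛ-∙ a _) (≈-trans (pair-∙ s t (z ∘ (n ↑ʳ_)))
               (+-congˡ (≈-trans (*-congˡ z₁≈1) (*-identityʳ t)))) ⟩
        - (a ∙ (z ∘ (_↑ˡ 2))) + (s * objective n z + t) ≈⟨ +-comm _ _ ⟩
        (s * objective n z + t) - a ∙ (z ∘ (_↑ˡ 2)) ∎
        where open SetoidReasoning setoid

      cost-bound : ∀ t → 1# * t + 0# ≈ t
      cost-bound t = ≈-trans (+-identityʳ _) (*-identityˡ t)

      row-bound : ∀ t β → 0# * t + β ≈ β
      row-bound t β = ≈-trans (+-congʳ (zeroˡ t)) (+-identityˡ β)

      form⁻ : ∀ a s t z {β} → z (n ↑ʳ suc zero) ≈ 1# → s * objective n z + t ≈ β →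
              0# ≤ (negᵛ a V.++ pair s t) ∙ z → a ∙ (z ∘ (_↑ˡ 2)) ≤ β
      form⁻ a s t z z₁≈1 ≈β 0≤ = 0≤y-x⇒x≤y
        (≤-respʳ-≈ (≈-trans (form-value a s t z z₁≈1) (+-congʳ ≈β)) 0≤)

      form⁺ : ∀ a s t z {β} → z (n ↑ʳ suc zero) ≈ 1# → s * objective n z + t ≈ β →
              a ∙ (z ∘ (_↑ˡ 2)) ≤ β → 0# ≤ (negᵛ a V.++ pair s t) ∙ z
      form⁺ a s t z z₁≈1 ≈β a∙z≤β =
        ≤-respʳ-≈ (≈-sym (≈-trans (form-value a s t z z₁≈1) (+-congʳ ≈β))) (x≤y⇒0≤y-x a∙z≤β)

    epigraph⁻ : ∀ z → Feasible n epigraph z →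
      c ∙ (z ∘ (_↑ˡ 2)) ≤ objective n z × H · (z ∘ (_↑ˡ 2)) ≤ᵛ h
    epigraph⁻ z (cost ∷ rows , z₁≈1) =
      form⁻ c 1# 0# z z₁≈1 (cost-bound _) cost ,
      λ i → form⁻ (H i) 0# (h i) z z₁≈1 (row-bound _ (h i)) (All.tabulate⁻ rows i)

    epigraph⁺ : ∀ x → H · x ≤ᵛ h → Feasible n epigraph (x V.++ pair (c ∙ x) 1#)
    epigraph⁺ x Hx≤h =
      (form⁺ c 1# 0# z z₁≈1 (≈-trans (cost-bound _) z₀≈) (≤-reflexive (∙-congˡ c z≈x)) ∷
       All.tabulate⁺ λ i → form⁺ (H i) 0# (h i) z z₁≈1 (row-bound _ (h i))
         (≤-respˡ-≈ (≈-sym (∙-congˡ (H i) z≈x)) (Hx≤h i))) ,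
      z₁≈1
      where
      z = x V.++ pair (c ∙ x) 1#
      z≈x : z ∘ (_↑ˡ 2) ≈ᵛ x
      z≈x i = ≈-reflexive (V.lookup-++ˡ x (pair (c ∙ x) 1#) i)
      z₀≈ : objective n z ≈ c ∙ x
      z₀≈ = ≈-reflexive (V.lookup-++ʳ x (pair (c ∙ x) 1#) zero)
      z₁≈1 : z (n ↑ʳ suc zero) ≈ 1#
      z₁≈1 = ≈-reflexive (V.lookup-++ʳ x (pair (c ∙ x) 1#) (suc zero))

    -- At a lowest point of the epigraph the cost is at most the height, and every feasible `y`
    -- occurs in the epigraph at height `c ∙ y`.
    lp-minimiser : (∀ x → H · x ≤ᵛ h → 0# ≤ c ∙ x) → (∃[ x ] H · x ≤ᵛ h) →
      ∃[ x ] H · x ≤ᵛ h × (∀ y → H · y ≤ᵛ h → c ∙ x ≤ c ∙ y)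
    lp-minimiser nonneg (x , Hx≤h)
      with minimise n epigraph
        (λ z fz → let cz≤t , Hz≤h = epigraph⁻ z fz in ≤-trans (nonneg _ Hz≤h) cz≤t)
        (_ , epigraph⁺ x Hx≤h)
    ... | z , fz , z-min with epigraph⁻ z fz
    ...   | cz≤t , Hz≤h = _ , Hz≤h , λ y Hy≤h → begin
      c ∙ (z ∘ (_↑ˡ 2))                        ≤⟨ cz≤t ⟩
      objective n z                            ≤⟨ z-min _ (epigraph⁺ y Hy≤h) ⟩
      objective n (y V.++ pair (c ∙ y) 1#)     ≡⟨ V.lookup-++ʳ y (pair (c ∙ y) 1#) zero ⟩
      c ∙ y                                    ∎
      where open ≤-Reasoning

-- Rounding within the minimal face of a relaxed optimum.

module Rounding (ℝ : RealField) where

  open RealField ℝ hiding (zero)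
  open Polytopes ℝ
  open OrderedField ℝ
  open LinearForms ℝ
  open LinearProgram ℝ

  ∙-nonneg : ∀ {n} {c x : Point n} → c ∈ NonNegative → x ∈ NonNegative → 0# ≤ c ∙ x
  ∙-nonneg {zero}  0≤c 0≤x = ≤-refl
  ∙-nonneg {suc n} 0≤c 0≤x =
    +-nonneg (*-nonneg (0≤c zero) (0≤x zero)) (∙-nonneg (0≤c ∘ suc) (0≤x ∘ suc))

  -- Row `i` is a valid inequality, so the points of `P` where it is tight form a face. That face
  -- contains `x`, hence also the minimal face of `x`.
  minimalFace-tight : ∀ {n} (P : Polytope n) {x w F} → IsMinimalFace P x F → w ∈ F →
    ∀ i → Polytope.G P i ∙ x ≈ Polytope.h P i → Polytope.G P i ∙ w ≈ Polytope.h P i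
  minimalFace-tight P {x} {w} ((_ , _ , _ , F⊆ , _) , x∈F , minimal) w∈F i tight =
    proj₂ (minimal (λ y → y ∈ ⟦ P ⟧ × G i ∙ y ≈ h i)
      (G i , h i , (λ y y∈P → y∈P i) , (λ _ p → p) , (λ _ p → p))
      (proj₁ (F⊆ x x∈F) , tight) w w∈F)
    where open Polytope P

  small-step : ∀ {n} (P : Polytope n) {x y w F} → IsMinimalFace P x F → w ∈ F →
    x ∈ ⟦ P ⟧ → y ∈ ⟦ P ⟧ → ∃[ τ ] 0# < τ × τ ≤ 1# × towards τ x y w ∈ ⟦ P ⟧
  small-step P {x} {y} {w} minimal w∈F x∈P y∈P
    with common-step-size (λ i τ → G i ∙ x + τ * (G i ∙ y - G i ∙ w) ≤ h i)
      -- On a row tight at `x`, `w` attains `h i` while `y` stays at or below it, so the direction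
      -- `y - w` does not increase the row.
      (λ i → step-size (x∈P i) λ tight → ≤-respʳ-≈ (-‿inverseʳ (h i)) (+-mono-≤ (y∈P i)
        (≤-reflexive (-‿cong (minimalFace-tight P minimal w∈F i tight)))))
    where open Polytope P
  ... | τ , 0<τ , τ≤1 , bound = τ , 0<τ , τ≤1 , λ i →
    ≤-respˡ-≈ (≈-sym (∙-towards (Polytope.G P i) τ x y w)) (bound i)

  module _ {n m} (P : Polytope n) (P≥0 : ⟦ P ⟧ ⊆′ NonNegative) (I : Instance m n)
           (δ : Point m) (δ≥0 : δ ∈ NonNegative) where

    open Instance I
    open Polytope P

    RelaxedOptimal : Point n → Set
    RelaxedOptimal x = (x ∈ ⟦ P ⟧ × A · x ≤ᵛ b +ᵛ δ) ×
      (∀ y → y ∈ ⟦ P ⟧ → A · y ≤ᵛ b +ᵛ δ → c ∙ x ≤ c ∙ y)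

    relaxed-optimum : ∃ (LPFeasible P I) → ∃ RelaxedOptimal
    relaxed-optimum (y , y∈P , Ay≤b) =
      -- The rows of `P` and the relaxed constraints are stacked into one system; `y` satisfies the
      -- latter because `δ` is nonnegative.
      let x , Hx≤ , x-min = lp-minimiser (G V.++ A) (h V.++ (b +ᵛ δ)) c
            (λ x Hx≤ → ∙-nonneg c≥0 (P≥0 x (proj₁ (stacked⁻ x Hx≤))))
            (y , stacked⁺ y y∈P λ i → ≤-respˡ-≈ (+-identityʳ _) (+-mono-≤ (Ay≤b i) (δ≥0 i)))
      in x , stacked⁻ x Hx≤ , λ y y∈P Ay≤ → x-min y (stacked⁺ y y∈P Ay≤)
      where
      Holds : Point n → Point n → Carrier → Set
      Holds x a β = a ∙ x ≤ β
      stacked⁺ : ∀ x → x ∈ ⟦ P ⟧ → A · x ≤ᵛ b +ᵛ δ → (G V.++ A) · x ≤ᵛ h V.++ (b +ᵛ δ)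
      stacked⁺ x = ++⁺ (Holds x)
      stacked⁻ : ∀ x → (G V.++ A) · x ≤ᵛ h V.++ (b +ᵛ δ) → x ∈ ⟦ P ⟧ × A · x ≤ᵛ b +ᵛ δ
      stacked⁻ x = ++⁻ (Holds x) G h

    rounded-cost : ∀ {x y w F} → RelaxedOptimal x → IsMinimalFace P x F → w ∈ F →
      A · x -ᵛ δ ≤ᵛ A · w → LPFeasible P I y → c ∙ w ≤ c ∙ y
    rounded-cost {x} {y} {w} ((x∈P , Ax≤) , x-min) minimal w∈F Ax-δ≤Aw (y∈P , Ay≤b)
      with small-step P minimal w∈F x∈P y∈P
    ... | τ , 0<τ , τ≤1 , z∈P = 0≤y-x⇒x≤y (*-cancel-nonneg 0<τ 0≤τ[cy-cw])
      where
      z = towards τ x y w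
      -- The error bound for `w` turns the change along `y - w` into at most the slack of `x` in the
      -- relaxed constraint, which is what `convex-step` needs.
      Ay-Aw≤ : ∀ i → A i ∙ y - A i ∙ w ≤ (b i + δ i) - A i ∙ x
      Ay-Aw≤ i = begin
        A i ∙ y - A i ∙ w               ≤⟨ +-mono-≤ (Ay≤b i) (neg-antimono-≤ (Ax-δ≤Aw i)) ⟩
        b i - (A i ∙ x - δ i)           ≈⟨ +-congˡ (⁻¹-anti-homo‿- (A i ∙ x) (δ i)) ⟩
        b i + (δ i - A i ∙ x)           ≈⟨ +-assoc (b i) (δ i) _ ⟨
        (b i + δ i) - A i ∙ x           ∎
        where open ≤-Reasoning
      Az≤ : A · z ≤ᵛ b +ᵛ δ
      Az≤ i = ≤-respˡ-≈ (≈-sym (∙-towards (A i) τ x y w))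
        (convex-step (Ax≤ i) (Ay-Aw≤ i) (proj₁ 0<τ) τ≤1)
      0≤τ[cy-cw] : 0# ≤ τ * (c ∙ y - c ∙ w)
      -- Moving from `x` to `z` changes the cost by exactly `τ * (c ∙ y - c ∙ w)`, and `x` is
      -- optimal.
      0≤τ[cy-cw] = ≤-respʳ-≈ (xyx⁻¹≈y (c ∙ x) _)
        (x≤y⇒0≤y-x (≤-respʳ-≈ (∙-towards c τ x y w) (x-min z z∈P Az≤)))

theorem10 : (ℝ : RealField) →
    let open RealField ℝ
        open Polytopes ℝ in
    ∀ {n : ℕ} (P : Polytope n) → ⟦ P ⟧ ⊆′ NonNegative →
    (Δ : ErrorBound n) →
    ∀ {m : ℕ} (I : Instance m n) → errorOn Δ I ∈ NonNegative →
    ∀ OPT → IsOPT P I OPT →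
    let open Instance I in
    ∃[ x ] x ∈ ⟦ P ⟧ ×
      ((𝒜 : FPRA P) → HasError 𝒜 Δ →
        let x̃ = FPRA.round 𝒜 I x in
        IsExtremePoint P x̃ ×
        c ∙ x̃ ≤ OPT ×
        A · x̃ ≤ᵛ b +ᵛ (errorOn Δ I +ᵛ errorOn Δ I))
theorem10 ℝ P P≥0 Δ I Δ≥0 OPT ((y , y-feasible , cy≈OPT) , _)
  with Rounding.relaxed-optimum ℝ P P≥0 I (Polytopes.errorOn ℝ Δ I) Δ≥0 (y , y-feasible)
... | x , x-optimal@((x∈P , Ax≤) , _) = x , x∈P , λ 𝒜 error →
  let open Polytopes.FPRA 𝒜
      -- The algorithm receives the original instance `I`; the relaxed right-hand side enters only
      -- through the choice of `x`.
      _ , minimal , x̃∈F = face-preserving I x x∈P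
      lower , upper = error I x x∈P
  in round-extreme I x x∈P ,
     ≤-respʳ-≈ cy≈OPT (rounded-cost P P≥0 I δ Δ≥0 x-optimal minimal x̃∈F lower y-feasible) ,
     -- One `δ` comes from the relaxation and the other from the rounding.
     λ i → ≤-respʳ-≈ (+-assoc _ _ _) (≤-trans (upper i) (+-monoˡ-≤ (δ i) (Ax≤ i)))
  where
  open RealField ℝ
  open OrderedField ℝ
  open Rounding ℝ
  δ = Polytopes.errorOn ℝ Δ I
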